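{- Let $k$ be a fixed positive integer. The algorithm det-$k$-decomp accepts a hypergraph $H$ if and only if $hw(H)\le k$.
   Context: **Hypergraphs.** A hypergraph $H$ is a pair $(V,E)$ with $V$ a set of vertices and $E\subseteq 2^V\setminus\{\emptyset\}$ a set of hyperedges, where it is assumed that $V\setminus\bigcup E=\emptyset$. Write $vertices(H)=V$, $edges(H)=E$. For a set $S$ of hyperedges, $\bigcup S$ is the set of vertices contained in some member of $S$. **Hypertree decompositions.** A hypertree for $H$ is a triple $(T,\chi,\lambda)$ where $T$ is a rooted tree with node set $vertices(T)$, $\chi: vertices(T)\to 2^{vertices(H)}$ and $\lambda: vertices(T)\to 2^{edges(H)}$. For $p\in vertices(T)$, $T_p$ is the subtree rooted at $p$, and for a subtree $T'$, $\chi(T')$ is the union of $\chi(p)$ over the nodes $p$ of $T'$. A hypertree decomposition of $H$ is a hypertree $(T,\chi,\lambda)$ for $H$ such that: (1) for each $e\in edges(H)$ there is $p\in vertices(T)$ with $e\subseteq\chi(p)$; (2) for each $v\in vertices(H)$ the set $\{p\in vertices(T) : v\in\chi(p)\}$ induces a connected subtree of $T$; (3) for each $p\in vertices(T)$, $\chi(p)\subseteq\bigcup\lambda(p)$; (4) for each $p\in vertices(T)$, $\bigcup\lambda(p)\cap\chi(T_p)\subseteq\chi(p)$. Its width is $\max_{p}|\lambda(p)|$, and the hypertree-width $hw(H)$ is the minimum width over all hypertree decompositions of $H$. **Components.** For $W\subseteq V$, a set $V'\subseteq V$ is $[W]$-connected if any two of its vertices are joined by a path (a sequence of vertices in which consecutive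 vertices lie in a common hyperedge) not going through vertices in $W$. A $[W]$-component is a maximal $[W]$-connected non-empty set $V'\subseteq V\setminus W$. In the algorithm, a component is represented by the set of hyperedges containing at least one vertex of the component, and a separator $W$ by a set of hyperedges. **Auxiliary procedures.** - $separate(Edges,Separator)$: returns the set of components (each represented as a set of hyperedges) of the sub-hypergraph with hyperedge set $Edges$ with respect to $\bigcup Separator$; i.e. for each connected component $C$ of $\bigcup Edges\setminus\bigcup Separator$ (connectivity via hyperedges of $Edges$, avoiding $\bigcup Separator$) it contains the set of those $e\in Edges$ with $e\cap C\ne\emptyset$. - $cover(Conn,BoundEdges)$: successively returns sets $CovSep\subseteq BoundEdges$ with $|CovSep|\le k$ and $Conn\subseteq\bigcup CovSep$, such that at least all minimal such covers are returned (for $Conn=\emptyset$ this includes $CovSep=\emptyset$). - $getHTNode(L,X,Subtrees)$: constructs a hypertree node with $\lambda$-label $L$, $\chi$-label $X$ and child subtrees $Subtrees$. - $expand(HTree)$: expands the pruned nodes (those created in step (a) of $decompSub$ below) to full subtrees after the search. **The algorithm det-$k$-decomp**, on input a hypergraph $H$. Global variables $FailSeps$ and $SuccSeps$ are initialized to $\emptyset$. Compute $HTree:=decompCov(edges(H),\emptyset)$; if $HTree\ne$ NULL, set $HTree:=expand(HTree)$; return $HTree$. The algorithm *rejects* $H$ if the returned value is NULL, and *accepts* $H$ if it returns a hypertree. The procedures are: $decompCov(Edges,Conn)$: If $|Edges|\le k$, return $getHTNode(Edges,\bigcup Edges,\emptyset)$. Otherwise let $BoundEdges:=\{e\in edges(H)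 : e\cap Conn\neq\emptyset\}$. For each $CovSep\in cover(Conn,BoundEdges)$: let $HTree:=decompAdd(Edges,Conn,CovSep)$; if $HTree\ne$ NULL, return $HTree$. After the loop return NULL. $decompAdd(Edges,Conn,CovSep)$: Let $InCovSep:=CovSep\cap Edges$. If $InCovSep\ne\emptyset$ or $k-|CovSep|>0$: set $AddSize:=1$ if $InCovSep=\emptyset$ and $AddSize:=0$ otherwise; for each $AddSep\subseteq Edges$ with $|AddSep|=AddSize$: let $Separator:=CovSep\cup AddSep$ and $Components:=separate(Edges,Separator)$; if $\langle Separator,Comp\rangle\notin FailSeps$ for all $Comp\in Components$, then let $Subtrees:=decompSub(Components,Separator)$, and if $Subtrees\ne\emptyset$, let $Chi:=Conn\cup\bigcup(InCovSep\cup AddSep)$ and return $getHTNode(Separator,Chi,Subtrees)$. If nothing has been returned, return NULL. $decompSub(Components,Separator)$: Let $Subtrees:=\emptyset$. For each $Comp\in Components$: let $ChildConn:=\bigcup Comp\cap\bigcup Separator$. (a) If $\langle Separator,Comp\rangle\in SuccSeps$, let $HTree:=getHTNode(Comp,ChildConn,\emptyset)$ (a pruned node). (b) Otherwise let $HTree:=decompCov(Comp,ChildConn)$; if $HTree=$ NULL, add $\langle Separator,Comp\rangle$ to $FailSeps$ and return $\emptyset$; else add $\langle Separator,Comp\rangle$ to $SuccSeps$. If the procedure has not returned, set $Subtrees:=Subtrees\cup\{HTree\}$. After the loop return $Subtrees$.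
   Formalization: Failure of decompSub is kept distinct from a successful return of an empty set of subtrees (Components = ∅); with the literal test Subtrees ≠ ∅ the claim is false, e.g. k = 1 and hyperedges {a,b},{a},{b}, where hw = 1 but the algorithm rejects. -}

module Defs where

open import Data.Bool using (if_then_else_)
import Data.Bool.Properties as Bool
open import Data.Fin using (Fin)
open import Data.Fin.Properties using (any?)
open import Data.Fin.Subset using (Subset; _∈_; _∉_; _⊆_; _∩_; _∪_; ∣_∣; Nonempty; ⊤; ⊥)
open import Data.Fin.Subset.Properties
  using (_∈?_; nonempty?; p⊂q⇒∣p∣<∣q∣; x∈p∩q⁻; x∈p∪q⁺; ∣⊥∣≡0; Empty-unique)
open import Data.List using (List; []; _∷_)
open import Data.List.Membership.Propositional using () renaming (_∈_ to _∈ˡ_)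
import Data.List.Membership.DecPropositional as DecMembership
open import Data.List.Relation.Unary.All using (All; []; _∷_; tabulate)
import Data.List.Relation.Unary.Any as Any
open import Data.List.Relation.Unary.Unique.Propositional using (Unique)
open import Data.Maybe using (Maybe; just; nothing; Is-just)
import Data.Maybe as Maybe
open import Data.Nat using (ℕ; _∸_; _⊔_; _≤_; _<_; _≤?_; _>?_)
open import Data.Nat.Induction using (<-wellFounded)
open import Data.Product using (∃; _×_; _,_; proj₁; proj₂)
open import Data.Product.Properties using (≡-dec)
open import Data.Sum using (inj₁; inj₂)
import Data.Vec as Vec
import Data.Vec.Properties as Vec
open import Function using (_∘_; _⇔_; Injective; module Equivalence)
open import Induction.WellFounded using (Acc; acc)
open import Relation.Binary using (DecidableEquality)
open import Relation.Binary.Construct.Closure.Equivalence using (EqClosure)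
open import Relation.Binary.Construct.Closure.ReflexiveTransitive using (Star)
open import Relation.Binary.PropositionalEquality using (_≡_; refl; sym; trans; cong)
open import Relation.Nullary using (yes; no; does)
open import Relation.Nullary.Decidable using (_×-dec_; _⊎-dec_; dec-true)
open import Relation.Unary using (Decidable)

private
  variable
    n : ℕ

comprehension : {P : Fin n → Set} → Decidable P → Subset n
comprehension P? = Vec.tabulate (does ∘ P?)

∈-comprehension⁻ : {P : Fin n → Set} (P? : Decidable P) →
                   ∀ {x} → x ∈ comprehension P? → P x
∈-comprehension⁻ P? {x} x∈ with P? x | Vec.lookup∘tabulate (does ∘ P?) x
... | yes px | _  = px
... | no _   | eq with () ← trans (sym (Vec.[]=⇒lookup x∈)) eq

∈-comprehension⁺ : {P : Fin n → Set} (P? : Decidable P) →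
                   ∀ {x} → P x → x ∈ comprehension P?
∈-comprehension⁺ P? {x} px = Vec.lookup⇒[]= x _
  (trans (Vec.lookup∘tabulate (does ∘ P?) x) (dec-true (P? x) px))

-- A finite hypergraph on the vertices Fin order.  Injectivity of edge makes
-- the family of hyperedges a set, so sets of hyperedges are subsets of Fin size.
record Hypergraph : Set where
  field
    order         : ℕ
    size          : ℕ
    edge          : Fin size → Subset order
    edge-distinct : Injective _≡_ _≡_ edge
    edge-nonempty : ∀ e → Nonempty (edge e)
    no-isolated   : ∀ v → ∃ λ e → v ∈ edge e

module _ (H : Hypergraph) where
  open Hypergraph H

  VertexSet EdgeSet : Set
  VertexSet = Subset order
  EdgeSet   = Subset size

  ⋃ : EdgeSet → VertexSet
  ⋃ S = comprehension λ v → any? λ e → (e ∈? S) ×-dec (v ∈? edge e)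

  edges : EdgeSet
  edges = ⊤

  edgesMeeting : EdgeSet → VertexSet → EdgeSet
  edgesMeeting S X = comprehension λ e → (e ∈? S) ×-dec nonempty? (edge e ∩ X)

  module _ (S : EdgeSet) (W : VertexSet) where

    data Step (u v : Fin order) : Set where
      step : ∀ e → e ∈ S → u ∈ edge e → v ∈ edge e → u ∉ W → v ∉ W → Step u v

    Connected : VertexSet → Set
    Connected X = ∀ {u v} → u ∈ X → v ∈ X → Star Step u v

    record IsConnectedPart (X : VertexSet) : Set where
      field
        nonempty  : Nonempty X
        within    : X ⊆ ⋃ S
        avoids    : ∀ {v} → v ∈ X → v ∉ W
        connected : Connected X

    record IsComponent (X : VertexSet) : Set where
      field
        isConnectedPart : IsConnectedPart X
        maximal         : ∀ Y → IsConnectedPart Y → X ⊆ Y → Y ≡ X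

  -- A component is represented by the set of hyperedges meeting it.
  Represents : EdgeSet → EdgeSet → EdgeSet → Set
  Represents S Separator Comp =
    ∃ λ X → IsComponent S (⋃ Separator) X × Comp ≡ edgesMeeting S X

  data Hypertree : Set where
    node : (L : EdgeSet) (X : VertexSet) (children : List Hypertree) → Hypertree

  -- Nodes are positions, so equal subtrees at different places stay distinct.
  data Node : Hypertree → Set where
    root    : ∀ {t} → Node t
    descend : ∀ {L X ts t} → t ∈ˡ ts → Node t → Node (node L X ts)

  subtree : ∀ {t} → Node t → Hypertree
  subtree {t} root      = t
  subtree (descend _ p) = subtree p

  λ-label : Hypertree → EdgeSet
  λ-label (node L _ _) = L

  χ-label : Hypertree → VertexSet
  χ-label (node _ X _) = X

  λ[_] : ∀ {t} → Node t → EdgeSet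
  λ[ p ] = λ-label (subtree p)

  χ[_] : ∀ {t} → Node t → VertexSet
  χ[ p ] = χ-label (subtree p)

  data ParentOf : ∀ {t} → Node t → Node t → Set where
    here  : ∀ {L X ts t} (i : t ∈ˡ ts) →
            ParentOf {node L X ts} root (descend i root)
    there : ∀ {L X ts t} {p q : Node t} (i : t ∈ˡ ts) → ParentOf p q →
            ParentOf {node L X ts} (descend i p) (descend i q)

  InducesConnected : ∀ {t} → (Node t → Set) → Set
  InducesConnected P = ∀ p q → P p → P q →
    EqClosure (λ p′ q′ → ParentOf p′ q′ × P p′ × P q′) p q

  record IsHypertreeDecomposition (t : Hypertree) : Set where
    field
      edges-covered : ∀ e → ∃ λ (p : Node t) → edge e ⊆ χ[ p ]
      connectedness : ∀ v → InducesConnected (λ (p : Node t) → v ∈ χ[ p ])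
      χ⊆⋃λ          : ∀ (p : Node t) → χ[ p ] ⊆ ⋃ λ[ p ]
      special       : ∀ (p : Node t) {v} → v ∈ ⋃ λ[ p ] →
                      (∃ λ (q : Node (subtree p)) → v ∈ χ[ q ]) → v ∈ χ[ p ]

  mutual
    width : Hypertree → ℕ
    width (node L _ ts) = ∣ L ∣ ⊔ maxWidth ts

    maxWidth : List Hypertree → ℕ
    maxWidth []       = 0
    maxWidth (t ∷ ts) = width t ⊔ maxWidth ts

  -- The minimum is given by its graph: as a function it would already need a
  -- decision procedure for the existence of decompositions of a given width.
  IsHypertreeWidth : ℕ → Set
  IsHypertreeWidth w =
      (∃ λ t → IsHypertreeDecomposition t × width t ≡ w)
    × (∀ t → IsHypertreeDecomposition t → w ≤ width t)

  record IsBoundedCover (k : ℕ) (Conn : VertexSet) (BoundEdges CovSep : EdgeSet) : Set where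
    field
      bounded : CovSep ⊆ BoundEdges
      small   : ∣ CovSep ∣ ≤ k
      covers  : Conn ⊆ ⋃ CovSep

  -- The procedures are known only through their specification; in particular
  -- the order in which the sets are enumerated is arbitrary.
  record Procedures (k : ℕ) : Set where
    field
      separate          : EdgeSet → EdgeSet → List EdgeSet
      separate-unique   : ∀ Edges Separator → Unique (separate Edges Separator)
      separate-spec     : ∀ Edges Separator Comp →
                          Comp ∈ˡ separate Edges Separator ⇔ Represents Edges Separator Comp

      cover             : VertexSet → EdgeSet → List EdgeSet
      cover-sound       : ∀ Conn BoundEdges CovSep → CovSep ∈ˡ cover Conn BoundEdges →
                          IsBoundedCover k Conn BoundEdges CovSep
      cover-complete    : ∀ Conn BoundEdges CovSep →
                          IsBoundedCover k Conn BoundEdges CovSep →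
                          (∀ S → IsBoundedCover k Conn BoundEdges S → S ⊆ CovSep → S ≡ CovSep) →
                          CovSep ∈ˡ cover Conn BoundEdges

      subsets           : EdgeSet → ℕ → List EdgeSet
      subsets-unique    : ∀ Edges s → Unique (subsets Edges s)
      subsets-spec      : ∀ Edges s A → A ∈ˡ subsets Edges s ⇔ (A ⊆ Edges × ∣ A ∣ ≡ s)

      -- Nothing is required of expand, since it is only applied to hypertrees
      -- and so cannot turn acceptance into rejection or conversely.
      expand            : Hypertree → Hypertree

  component-smaller : ∀ S Separator Comp {e} → Represents S Separator Comp →
                      e ∈ S → e ∈ Separator → ∣ Comp ∣ < ∣ S ∣
  component-smaller S Separator Comp {e} (X , isC , refl) e∈S e∈Sep =
    p⊂q⇒∣p∣<∣q∣ (proj₁ ∘ ∈-comprehension⁻ meets? , e , e∈S , e∉)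
    where
    meets? = λ e → (e ∈? S) ×-dec nonempty? (edge e ∩ X)

    e∉ : e ∉ edgesMeeting S X
    e∉ e∈ with ∈-comprehension⁻ meets? e∈
    ... | _ , v , v∈ =
      IsConnectedPart.avoids (IsComponent.isConnectedPart isC)
        (proj₂ (x∈p∩q⁻ _ _ v∈))
        (∈-comprehension⁺ (λ v → any? λ e → (e ∈? Separator) ×-dec (v ∈? edge e))
          (e , e∈Sep , proj₁ (x∈p∩q⁻ _ _ v∈)))

nonempty-of-size-1 : ∀ {n} (A : Subset n) → ∣ A ∣ ≡ 1 → Nonempty A
nonempty-of-size-1 {n} A ∣A∣≡1 with nonempty? A
... | yes ne = ne
... | no ¬ne with () ← trans (sym ∣A∣≡1) (trans (cong ∣_∣ (Empty-unique ¬ne)) (∣⊥∣≡0 n))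

module Algorithm (k : ℕ) (H : Hypergraph) (procedures : Procedures H k) where
  open Hypergraph H
  open Procedures procedures
  open Equivalence using (to)

  private
    _≟_ : DecidableEquality (EdgeSet H × EdgeSet H)
    _≟_ = ≡-dec (Vec.≡-dec Bool._≟_) (Vec.≡-dec Bool._≟_)

  open DecMembership _≟_ using () renaming (_∈?_ to _∈ˡ?_)

  record State : Set where
    constructor state
    field
      FailSeps SuccSeps : List (EdgeSet H × EdgeSet H)

  -- Failure, including the value NULL, is nothing.
  Run : Set → Set
  Run A = State → Maybe A × State

  forEach : {A B : Set} (xs : List A) → (∀ x → x ∈ˡ xs → Run B) → Run B
  forEach []       body s = nothing , s
  forEach (x ∷ xs) body s with body x (Any.here refl) s
  ... | just b  , s′ = just b , s′
  ... | nothing , s′ = forEach xs (λ y y∈xs → body y (Any.there y∈xs)) s′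

  -- The calls of decompCov available while treating Edges: they must be made on
  -- fewer hyperedges, which makes the recursion well founded.
  Recursive : EdgeSet H → Set
  Recursive Edges = ∀ (Comp : EdgeSet H) → ∣ Comp ∣ < ∣ Edges ∣ → VertexSet H → Run (Hypertree H)

  -- Failure is nothing rather than an empty set of subtrees, which is what a
  -- successful call without components returns: a separator covering all of
  -- Edges leaves nothing to decompose.  Were the two identified, the algorithm
  -- would reject the complete graph K₄ for k = 2, although hw(K₄) = 2.
  decompSub : ∀ Edges → Recursive Edges → (Components : List (EdgeSet H)) →
              All (λ Comp → ∣ Comp ∣ < ∣ Edges ∣) Components →
              EdgeSet H → List (Hypertree H) → Run (List (Hypertree H))
  decompSub Edges rec [] [] Separator Subtrees s = just Subtrees , s
  decompSub Edges rec (Comp ∷ Comps) (lt ∷ lts) Separator Subtrees s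
    with (Separator , Comp) ∈ˡ? State.SuccSeps s
  ... | yes _ = decompSub Edges rec Comps lts Separator
                  (node Comp (⋃ H Comp ∩ ⋃ H Separator) [] ∷ Subtrees) s
  ... | no _ with rec Comp lt (⋃ H Comp ∩ ⋃ H Separator) s
  ...   | nothing    , state F S = nothing , state ((Separator , Comp) ∷ F) S
  ...   | just HTree , state F S = decompSub Edges rec Comps lts Separator (HTree ∷ Subtrees)
                                     (state F ((Separator , Comp) ∷ S))

  addSize : EdgeSet H → ℕ
  addSize InCovSep = if does (nonempty? InCovSep) then 0 else 1

  separator-meets : ∀ Edges CovSep AddSep →
    AddSep ∈ˡ subsets Edges (addSize (CovSep ∩ Edges)) →
    ∃ λ e → e ∈ Edges × e ∈ CovSep ∪ AddSep
  separator-meets Edges CovSep AddSep A∈ with nonempty? (CovSep ∩ Edges)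
  ... | yes (e , e∈) =
    e , proj₂ (x∈p∩q⁻ CovSep Edges e∈) , x∈p∪q⁺ (inj₁ (proj₁ (x∈p∩q⁻ CovSep Edges e∈)))
  ... | no _ with to (subsets-spec Edges 1 AddSep) A∈
  ...   | A⊆ , ∣A∣≡1 with nonempty-of-size-1 AddSep ∣A∣≡1
  ...     | e , e∈A = e , A⊆ e∈A , x∈p∪q⁺ (inj₂ e∈A)

  components-smaller : ∀ Edges Separator →
    (∃ λ e → e ∈ Edges × e ∈ Separator) →
    All (λ Comp → ∣ Comp ∣ < ∣ Edges ∣) (separate Edges Separator)
  components-smaller Edges Separator (e , e∈E , e∈S) = tabulate λ {Comp} C∈ →
    component-smaller H Edges Separator Comp (to (separate-spec Edges Separator Comp) C∈) e∈E e∈S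

  trySeparator : ∀ Edges → Recursive Edges → VertexSet H → (CovSep AddSep : EdgeSet H) →
                 AddSep ∈ˡ subsets Edges (addSize (CovSep ∩ Edges)) → Run (Hypertree H)
  trySeparator Edges rec Conn CovSep AddSep A∈ s
    with Any.any? (λ Comp → (CovSep ∪ AddSep , Comp) ∈ˡ? State.FailSeps s)
                  (separate Edges (CovSep ∪ AddSep))
  ... | yes _ = nothing , s
  ... | no _ with decompSub Edges rec (separate Edges (CovSep ∪ AddSep))
                    (components-smaller Edges (CovSep ∪ AddSep)
                      (separator-meets Edges CovSep AddSep A∈))
                    (CovSep ∪ AddSep) [] s
  ...   | nothing       , s′ = nothing , s′
  ...   | just Subtrees , s′ =
    just (node (CovSep ∪ AddSep) (Conn ∪ ⋃ H ((CovSep ∩ Edges) ∪ AddSep)) Subtrees) , s′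

  decompAdd : ∀ Edges → Recursive Edges → VertexSet H → EdgeSet H → Run (Hypertree H)
  decompAdd Edges rec Conn CovSep s
    with nonempty? (CovSep ∩ Edges) ⊎-dec (k ∸ ∣ CovSep ∣ >? 0)
  ... | yes _ = forEach (subsets Edges (addSize (CovSep ∩ Edges)))
                  (trySeparator Edges rec Conn CovSep) s
  ... | no _  = nothing , s

  decompCov : ∀ Edges → Acc _<_ ∣ Edges ∣ → VertexSet H → Run (Hypertree H)
  decompCov Edges (acc rs) Conn s with ∣ Edges ∣ ≤? k
  ... | yes _ = just (node Edges (⋃ H Edges) []) , s
  ... | no _  = forEach (cover Conn (edgesMeeting H (edges H) Conn))
                  (λ CovSep _ → decompAdd Edges (λ Comp lt → decompCov Comp (rs lt)) Conn CovSep) s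

  det-k-decomp : Maybe (Hypertree H)
  det-k-decomp =
    Maybe.map expand (proj₁ (decompCov (edges H) (<-wellFounded ∣ edges H ∣) ⊥ (state [] [])))

  Accepts : Set
  Accepts = Is-just det-k-decomp

module Submission where

-- Reachability of success is first freed from the search state: Win E C holds when some
-- choice of separators decomposes E with boundary C.  FailSeps then only ever records
-- unwinnable and SuccSeps winnable calls, so decompCov decides Win.  A win yields a tree
-- with χ(p) = ⋃λ(p) ∩ ⋃E, which makes the special condition immediate.  Conversely, a
-- decomposition of width ≤ k guides a win: while the search works on a component all of
-- whose hyperedges are covered below p, with boundary inside χ(p), it can use a separator
-- inside λ(p) as long as some hyperedge of λ(p) meets the component, and moves to the only
-- child of p below which the component lies as soon as none does.
open import Defs
import Data.Bool.Properties as Bool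
open import Data.Fin using (Fin)
open import Data.Fin.Properties using (any?; sequence)
open import Data.Fin.Subset
  using (Subset; inside; outside; _∈_; _∉_; _⊆_; _∩_; _∪_; _-_; ∁; ⁅_⁆; ⊤; ⊥; ∣_∣; Nonempty)
open import Data.Fin.Subset.Properties
open import Data.List using (List; []; _∷_; filter)
open import Data.List.Membership.Propositional using (find; lose) renaming (_∈_ to _∈ˡ_)
open import Data.List.Membership.Propositional.Properties using (∈-filter⁺; ∈-filter⁻)
open import Data.List.Relation.Binary.Pointwise using (Pointwise; []; _∷_)
open import Data.List.Relation.Unary.All as All using (All; []; _∷_)
open import Data.List.Relation.Unary.Any as Any using (here; there)
open import Data.List.Relation.Unary.Unique.Propositional using (Unique; []; _∷_)
open import Data.Maybe using (Maybe; just; nothing; fromMaybe)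
import Data.Maybe.Relation.Binary.Pointwise as Maybe
import Data.Maybe.Relation.Unary.Any as MaybeAny
open import Data.Nat
  using (ℕ; zero; suc; _+_; _∸_; _≤_; _<_; _>_; _≤?_; _>?_; z≤n; s≤s; NonZero)
open import Data.Nat.Induction using (<-wellFounded)
open import Data.Nat.Properties hiding (_≟_)
open import Data.Product using (∃; _×_; _,_; proj₁; proj₂)
open import Data.Product.Properties using (≡-dec)
open import Data.Sum using (_⊎_; inj₁; inj₂)
open import Data.Unit using (tt)
open import Data.Vec using ([]; _∷_)
import Data.Vec.Properties as Vec
open import Effect.Monad using (RawMonad)
open import Function using (_∘_; _⇔_; id; mk⇔; module Equivalence)
open import Induction.WellFounded using (Acc; acc)
open import Relation.Binary.Construct.Closure.Equivalence as Eq using (EqClosure)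
open import Relation.Binary.Construct.Closure.ReflexiveTransitive
  using (Star; ε; _◅_; _◅◅_; reverse; kleisliStar)
open import Relation.Binary.Construct.Closure.Symmetric using (SymClosure; fwd; bwd)
open import Relation.Binary.PropositionalEquality
  using (_≡_; refl; sym; cong; subst; subst₂)
open import Relation.Nullary using (¬_; Dec; yes; no; ¬?; ¬¬-excluded-middle)
open import Relation.Nullary.Decidable using (_×-dec_; _⊎-dec_; decidable-stable; map′)
open import Relation.Nullary.Negation using (contradiction; ¬¬-map; ¬¬-Monad)
open import Relation.Unary using (Decidable)

-- Unions of hyperedges and components of a separator.

module _ (H : Hypergraph) where
  open Hypergraph H

  ∈-⋃? : (S : EdgeSet H) → Decidable (λ v → ∃ λ e → e ∈ S × v ∈ edge e)
  ∈-⋃? S v = any? λ e → (e ∈? S) ×-dec (v ∈? edge e)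

  meets? : (S : EdgeSet H) (X : VertexSet H) → Decidable (λ e → e ∈ S × Nonempty (edge e ∩ X))
  meets? S X e = (e ∈? S) ×-dec nonempty? (edge e ∩ X)

  ∈-⋃⁺ : ∀ {S e v} → e ∈ S → v ∈ edge e → v ∈ ⋃ H S
  ∈-⋃⁺ {S} e∈S v∈e = ∈-comprehension⁺ (∈-⋃? S) (_ , e∈S , v∈e)

  ∈-⋃⁻ : ∀ {S v} → v ∈ ⋃ H S → ∃ λ e → e ∈ S × v ∈ edge e
  ∈-⋃⁻ {S} = ∈-comprehension⁻ (∈-⋃? S)

  ⋃-mono : ∀ {S T} → S ⊆ T → ⋃ H S ⊆ ⋃ H T
  ⋃-mono S⊆T v∈ with e , e∈S , v∈e ← ∈-⋃⁻ v∈ = ∈-⋃⁺ (S⊆T e∈S) v∈e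

  ∈-edgesMeeting⁺ : ∀ {S X e v} → e ∈ S → v ∈ edge e → v ∈ X → e ∈ edgesMeeting H S X
  ∈-edgesMeeting⁺ {S} {X} e∈S v∈e v∈X =
    ∈-comprehension⁺ (meets? S X) (e∈S , _ , x∈p∩q⁺ (v∈e , v∈X))

  ∈-edgesMeeting⁻ : ∀ {S X e} → e ∈ edgesMeeting H S X → e ∈ S × ∃ λ v → v ∈ edge e × v ∈ X
  ∈-edgesMeeting⁻ {S} {X} {e} e∈ with e∈S , v , v∈ ← ∈-comprehension⁻ (meets? S X) e∈ =
    e∈S , v , x∈p∩q⁻ (edge e) X v∈

  module _ {S : EdgeSet H} {W : VertexSet H} where

    private
      _⇝_ : Fin order → Fin order → Set
      _⇝_ = Star (Step H S W)

    open IsConnectedPart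
    open IsComponent

    ⇝-sym : ∀ {u v} → u ⇝ v → v ⇝ u
    ⇝-sym = reverse λ { (step e e∈S u∈e v∈e u∉W v∉W) → step e e∈S v∈e u∈e v∉W u∉W }

    ⇝-avoids : ∀ {u v} → u ⇝ v → u ∈ ⋃ H S → u ∉ W → v ∈ ⋃ H S × v ∉ W
    ⇝-avoids ε u∈ u∉W = u∈ , u∉W
    ⇝-avoids (step e e∈S _ v∈e _ v∉W ◅ path) _ _ = ⇝-avoids path (∈-⋃⁺ e∈S v∈e) v∉W

    connectedPart : ∀ {X u} → u ∈ X → u ∈ ⋃ H S → u ∉ W → (∀ {v} → v ∈ X → u ⇝ v) →
                    IsConnectedPart H S W X
    connectedPart u∈X u∈ u∉W reach = record
      { nonempty  = _ , u∈X
      ; within    = λ v∈X → proj₁ (⇝-avoids (reach v∈X) u∈ u∉W)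
      ; avoids    = λ v∈X → proj₂ (⇝-avoids (reach v∈X) u∈ u∉W)
      ; connected = λ v∈X w∈X → ⇝-sym (reach v∈X) ◅◅ reach w∈X
      }

    -- All of `X ∪ Y` is reachable from the shared vertex `v`, so the union is again a connected
    -- part and maximality makes it equal to `X`.
    component-absorbs : ∀ {X Y v} → IsComponent H S W X → IsConnectedPart H S W Y →
                        v ∈ X → v ∈ Y → Y ⊆ X
    component-absorbs {X} {Y} {v} isX isY v∈X v∈Y y∈Y =
      subst (_ ∈_) (maximal isX (X ∪ Y) part (p⊆p∪q Y)) (q⊆p∪q X Y y∈Y)
      where
      partX = isConnectedPart isX
      reach : ∀ {w} → w ∈ X ∪ Y → v ⇝ w
      reach w∈ with x∈p∪q⁻ X Y w∈
      ... | inj₁ w∈X = connected partX v∈X w∈X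
      ... | inj₂ w∈Y = connected isY v∈Y w∈Y
      part = connectedPart (p⊆p∪q Y v∈X) (within partX v∈X) (avoids partX v∈X) reach

    component-unique : ∀ {X Y v} → IsComponent H S W X → IsComponent H S W Y →
                       v ∈ X → v ∈ Y → X ≡ Y
    component-unique isX isY v∈X v∈Y = ⊆-antisym
      (component-absorbs isY (isConnectedPart isX) v∈Y v∈X)
      (component-absorbs isX (isConnectedPart isY) v∈X v∈Y)

    -- The pair `⁅ u ⁆ ∪ ⁅ v ⁆` is itself a connected part, joined by a single step along `e`, and
    -- the component absorbs it.
    component-closed : ∀ {X e u v} → IsComponent H S W X → e ∈ S → u ∈ edge e → u ∈ X →
                       v ∈ edge e → v ∉ W → v ∈ X
    component-closed {X} {e} {u} {v} isX e∈S u∈e u∈X v∈e v∉W =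
      component-absorbs isX part u∈X (p⊆p∪q _ (x∈⁅x⁆ u)) (q⊆p∪q ⁅ u ⁆ _ (x∈⁅x⁆ v))
      where
      u∉W = avoids (isConnectedPart isX) u∈X
      reach : ∀ {w} → w ∈ ⁅ u ⁆ ∪ ⁅ v ⁆ → u ⇝ w
      reach w∈ with x∈p∪q⁻ ⁅ u ⁆ ⁅ v ⁆ w∈
      ... | inj₁ w∈u with refl ← x∈⁅y⁆⇒x≡y u w∈u = ε
      ... | inj₂ w∈v with refl ← x∈⁅y⁆⇒x≡y v w∈v = step e e∈S u∈e v∈e u∉W v∉W ◅ ε
      part = connectedPart (p⊆p∪q _ (x∈⁅x⁆ u)) (∈-⋃⁺ e∈S u∈e) u∉W reach

    -- The component consists of the vertices reachable from `v`. Forming it as a `Subset` requires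
    -- deciding reachability, which for finitely many vertices is available under a double negation.
    -- Decidable goals can use the result.
    component-exists : ∀ {v} → v ∈ ⋃ H S → v ∉ W → ¬ ¬ ∃ λ X → IsComponent H S W X × v ∈ X
    component-exists {v} v∈ v∉W =
      ¬¬-map component (sequence (RawMonad.rawApplicative ¬¬-Monad) (λ u → ¬¬-excluded-middle))
      where
      component : (∀ u → Dec (v ⇝ u)) → ∃ λ X → IsComponent H S W X × v ∈ X
      component reach? = comprehension reach? , isComponent , v∈X
        where
        v∈X = ∈-comprehension⁺ reach? ε
        isComponent : IsComponent H S W (comprehension reach?)
        isComponent = record
          { isConnectedPart = connectedPart v∈X v∈ v∉W (∈-comprehension⁻ reach?)
          ; maximal = λ Y isY X⊆Y → ⊆-antisym
              (λ y∈Y → ∈-comprehension⁺ reach? (connected isY (X⊆Y v∈X) y∈Y)) X⊆Y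
          }

  -- Passing from a tree to a child subtree: paths of nodes and connectedness.

  module _ {t : Hypertree H} where

    -- Positions are compared rather than trees, so equal siblings stay apart. At equal positions
    -- the two `refl` identify `t` with `t′`, which lets `p` be returned.
    locate : ∀ {ts t′} → t ∈ˡ ts → t′ ∈ˡ ts → Node H t′ → Maybe (Node H t)
    locate (here refl) (here refl) p = just p
    locate (here refl) (there _)   p = nothing
    locate (there _)   (here refl)   p = nothing
    locate (there i)   (there j)   p = locate i j p

    locate-self : ∀ {ts} (i : t ∈ˡ ts) p → locate i i p ≡ just p
    locate-self (here refl) p = refl
    locate-self (there i)   p = locate-self i p

    locate-χ : ∀ {ts t′} (i : t ∈ˡ ts) (j : t′ ∈ˡ ts) q {p} →
               locate i j q ≡ just p → χ[_] H p ≡ χ[_] H q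
    locate-χ (here refl) (here refl) q refl = refl
    locate-χ (here refl) (there _)   q ()
    locate-χ (there _)   (here refl) q ()
    locate-χ (there i)   (there j)   q eq   = locate-χ i j q eq

    -- An edge below position `j` lies wholly inside the child at `i` or wholly outside it;
    -- `Pointwise` on `Maybe` expresses both cases.
    locate-edge : ∀ {ts t′} (i : t ∈ˡ ts) (j : t′ ∈ˡ ts) {p q} → ParentOf H p q →
                  Maybe.Pointwise (ParentOf H) (locate i j p) (locate i j q)
    locate-edge (here refl) (here refl) pq = Maybe.just pq
    locate-edge (here refl) (there _)   pq = Maybe.nothing
    locate-edge (there _)   (here refl)   pq = Maybe.nothing
    locate-edge (there i)   (there j)   pq = locate-edge i j pq

    locate-root : ∀ {ts t′} (i : t ∈ˡ ts) (j : t′ ∈ˡ ts) {q} → locate i j root ≡ just q → q ≡ root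
    locate-root (here refl) (here refl) refl = refl
    locate-root (here refl) (there _)   ()
    locate-root (there _)   (here refl) ()
    locate-root (there i)   (there j)   eq   = locate-root i j eq

    module _ {L : EdgeSet H} {X : VertexSet H} {ts : List (Hypertree H)} (i : t ∈ˡ ts) where

      -- The partial inverse of `descend i`.
      inChild : Node H (node L X ts) → Maybe (Node H t)
      inChild root          = nothing
      inChild (descend j p) = locate i j p

      inChild-χ : ∀ q {p} → inChild q ≡ just p → χ[_] H p ≡ χ[_] H q
      inChild-χ (descend j q) = locate-χ i j q

  Occurs : Fin order → Hypertree H → Set
  Occurs v t = ∃ λ (p : Node H t) → v ∈ χ[_] H p

  Consistent : Hypertree H → Fin order → Set
  Consistent t v = InducesConnected H (λ (p : Node H t) → v ∈ χ[_] H p)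

  path-invariant : ∀ {A : Set} {R : A → A → Set} (Q : A → Set) →
                   (∀ {a b} → R a b → Q a → Q b) → (∀ {a b} → R a b → Q b → Q a) →
                   ∀ {a b} → EqClosure R a b → Q a → Q b
  path-invariant Q up down ε q = q
  path-invariant Q up down (fwd r ◅ rs) q = path-invariant Q up down rs (up r q)
  path-invariant Q up down (bwd r ◅ rs) q = path-invariant Q up down rs (down r q)

  module _ {L : EdgeSet H} {X : VertexSet H} {ts : List (Hypertree H)} {v : Fin order}
           (con : Consistent (node L X ts) v) {t : Hypertree H} (i : t ∈ˡ ts) where

    -- A path from the root to an occurrence of `v` inside the child can enter the child only at its
    -- root, and every node on the path contains `v`. The invariant `Q` is vacuous outside the child
    -- and is established at that entry.
    occurs-root : v ∈ X → Occurs v t → v ∈ χ-label H t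
    occurs-root v∈X (p , v∈p) =
      path-invariant Q (λ (e , _ , v∈b) → up e v∈b) (λ (e , v∈a , _) → down e v∈a)
        (con root (descend i p) v∈X v∈p) (λ ()) (locate-self i p)
      where
      Q : Node H (node L X ts) → Set
      Q a = ∀ {q} → inChild i a ≡ just q → v ∈ χ-label H t

      up : ∀ {a b} → ParentOf H a b → v ∈ χ[_] H b → Q a → Q b
      up (here j) v∈b _ eq with refl ← locate-root i j eq = subst (v ∈_) (sym (locate-χ i j root eq)) v∈b
      up (there {p = p} {q} j e) _ qa eq with locate i j p | locate i j q | locate-edge i j e
      ... | _ | _ | Maybe.just _ = qa refl

      down : ∀ {a b} → ParentOf H a b → v ∈ χ[_] H a → Q b → Q a
      down (there {p = p} {q} j e) _ qb eq with locate i j p | locate i j q | locate-edge i j e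
      ... | _ | _ | Maybe.just _ = qb refl

    -- Different children are linked only through the root. A path of nodes containing `v` cannot
    -- use it, so it never leaves the child at `i`.
    same-child : v ∉ X → Occurs v t → ∀ r → v ∈ χ[_] H r →
                 ∃ λ (q : Node H t) → χ[_] H q ≡ χ[_] H r
    same-child v∉X (p , v∈p) r v∈r = proj₁ found , inChild-χ i r (proj₂ found)
      where
      up : ∀ {a b} → ParentOf H a b → v ∈ χ[_] H a →
           (∃ λ q → inChild i a ≡ just q) → ∃ λ q → inChild i b ≡ just q
      up (there {p = p} {q} j e) _ (_ , eq) with locate i j p | locate i j q | locate-edge i j e
      ... | _ | _ | Maybe.just _ = _ , refl

      down : ∀ {a b} → ParentOf H a b → v ∈ χ[_] H a →
             (∃ λ q → inChild i b ≡ just q) → ∃ λ q → inChild i a ≡ just q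
      down (here j) v∈a _ = contradiction v∈a v∉X
      down (there {p = p} {q} j e) _ (_ , eq) with locate i j p | locate i j q | locate-edge i j e
      ... | _ | _ | Maybe.just _ = _ , refl

      found : ∃ λ q → inChild i r ≡ just q
      found = path-invariant (λ a → ∃ λ q → inChild i a ≡ just q)
        (λ (e , v∈a , _) → up e v∈a) (λ (e , v∈a , _) → down e v∈a)
        (con (descend i p) r v∈p v∈r) (p , locate-self i p)

    -- `clamp` retracts the whole tree onto the child by sending every outside node to the root of
    -- the child. Edges outside the child, and the edge entering it, become trivial; edges inside
    -- survive.
    consistent-child : Consistent t v
    consistent-child p q v∈p v∈q =
      subst₂ (EqClosure Along) (clamp-self p) (clamp-self q)
        (kleisliStar clamp clampStep (con (descend i p) (descend i q) v∈p v∈q))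
      where
      Along : ∀ {t} → Node H t → Node H t → Set
      Along p q = ParentOf H p q × v ∈ χ[_] H p × v ∈ χ[_] H q

      clamp : Node H (node L X ts) → Node H t
      clamp a = fromMaybe root (inChild i a)

      clamp-self : ∀ p → clamp (descend i p) ≡ p
      clamp-self p = cong (fromMaybe root) (locate-self i p)

      clampEdge : ∀ {a b} → Along a b → EqClosure Along (clamp a) (clamp b)
      clampEdge (here j , _) with locate i j root in eq
      ... | nothing = ε
      ... | just _ with refl ← locate-root i j eq = ε
      clampEdge (there {p = p} {q} j e , v∈a , v∈b)
        with locate i j p in eqp | locate i j q in eqq | locate-edge i j e
      ... | _ | _ | Maybe.nothing = ε
      ... | _ | _ | Maybe.just e′ =
        Eq.return (e′ , subst (v ∈_) (sym (locate-χ i j p eqp)) v∈a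
                   , subst (v ∈_) (sym (locate-χ i j q eqq)) v∈b)

      clampStep : ∀ {a b} → SymClosure Along a b → EqClosure Along (clamp a) (clamp b)
      clampStep (fwd e) = clampEdge e
      clampStep (bwd e) = Eq.symmetric Along (clampEdge e)

-- The search with its memoised state decides `Win`.

module _ (k : ℕ) (H : Hypergraph) (procedures : Procedures H k) where
  open Hypergraph H
  open Procedures procedures
  open Algorithm k H procedures

  data Win (E : EdgeSet H) (C : VertexSet H) : Set where
    leaf : ∣ E ∣ ≤ k → Win E C
    split : ∀ {CovSep AddSep} →
            CovSep ∈ˡ cover C (edgesMeeting H (edges H) C) →
            Nonempty (CovSep ∩ E) ⊎ k ∸ ∣ CovSep ∣ > 0 →
            AddSep ∈ˡ subsets E (addSize (CovSep ∩ E)) →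
            (∀ {Comp} → Comp ∈ˡ separate E (CovSep ∪ AddSep) →
              Win Comp (⋃ H Comp ∩ ⋃ H (CovSep ∪ AddSep))) →
            Win E C

  -- The boundary of a recursive call is a function of separator and component, so the stored pair
  -- determines the outcome completely.
  Solvable : EdgeSet H × EdgeSet H → Set
  Solvable (Separator , Comp) = Win Comp (⋃ H Comp ∩ ⋃ H Separator)

  record Sound (s : State) : Set where
    constructor sound
    open State s
    field
      fails : All (¬_ ∘ Solvable) FailSeps
      succs : All Solvable SuccSeps

  -- Either outcome also returns a sound state, so the invariant is available to the next call, even
  -- after a failure.
  data Verdict {A : Set} (P : Set) : Maybe A × State → Set where
    accept : ∀ {x s} → P → Sound s → Verdict P (just x , s)
    reject : ∀ {s} → ¬ P → Sound s → Verdict P (nothing , s)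

  Decides : {A : Set} → Set → Run A → Set
  Decides P run = ∀ s → Sound s → Verdict P (run s)

  verdict-map : ∀ {A : Set} {P Q : Set} {r : Maybe A × State} →
                (P → Q) → (Q → P) → Verdict P r → Verdict Q r
  verdict-map f g (accept p inv) = accept (f p) inv
  verdict-map f g (reject ¬p inv) = reject (¬p ∘ g) inv

  forEach-decides : ∀ {A B : Set} {P : A → Set} (xs : List A) (body : ∀ x → x ∈ˡ xs → Run B) →
                    (∀ x x∈ → Decides (P x) (body x x∈)) →
                    Decides (∃ λ x → x ∈ˡ xs × P x) (forEach xs body)
  forEach-decides [] body h s inv = reject (λ ()) inv
  forEach-decides (x ∷ xs) body h s inv with body x (here refl) s | h x (here refl) s inv
  ... | just _  , _ | accept p inv′ = accept (x , here refl , p) inv′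
  ... | nothing , s′ | reject ¬p inv′ =
    verdict-map (λ (y , y∈ , py) → y , there y∈ , py)
      (λ { (y , here refl , py) → contradiction py ¬p ; (y , there y∈ , py) → y , y∈ , py })
      (forEach-decides xs _ (λ y y∈ → h y (there y∈)) s′ inv′)

  -- Unfolds to the membership test of Algorithm, whose equality is private; only then does
  -- the with-abstraction in decompSub-decides find it.
  _∈ˡ?_ : (x : EdgeSet H × EdgeSet H) (xs : List (EdgeSet H × EdgeSet H)) → Dec (x ∈ˡ xs)
  x ∈ˡ? xs = Any.any? (≡-dec (Vec.≡-dec Bool._≟_) (Vec.≡-dec Bool._≟_) x) xs

  module _ (E : EdgeSet H) (rec : Recursive E)
           (h : ∀ Comp lt C → Decides (Win Comp C) (rec Comp lt C)) where

    decompSub-decides : ∀ Comps lts Separator Subtrees →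
      Decides (All (λ Comp → Solvable (Separator , Comp)) Comps)
              (decompSub E rec Comps lts Separator Subtrees)
    decompSub-decides [] [] Sep Ts s inv = accept [] inv
    decompSub-decides (Comp ∷ Comps) (lt ∷ lts) Sep Ts s inv
      with (Sep , Comp) ∈ˡ? State.SuccSeps s
    ... | yes m = verdict-map (All.lookup (Sound.succs inv) m ∷_) All.tail
                    (decompSub-decides Comps lts Sep _ s inv)
    ... | no _ with rec Comp lt (⋃ H Comp ∩ ⋃ H Sep) s | h Comp lt (⋃ H Comp ∩ ⋃ H Sep) s inv
    ...   | nothing , _ | reject ¬w (sound fs ss) = reject (¬w ∘ All.head) (sound (¬w ∷ fs) ss)
    ...   | just _ , _ | accept w (sound fs ss) = verdict-map (w ∷_) All.tail
              (decompSub-decides Comps lts Sep _ _ (sound fs (w ∷ ss)))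

    trySeparator-decides : ∀ C CovSep AddSep A∈ →
      Decides (All (λ Comp → Solvable (CovSep ∪ AddSep , Comp)) (separate E (CovSep ∪ AddSep)))
              (trySeparator E rec C CovSep AddSep A∈)
    trySeparator-decides C CovSep AddSep A∈ s inv
      with Any.any? (λ Comp → (CovSep ∪ AddSep , Comp) ∈ˡ? State.FailSeps s)
                    (separate E (CovSep ∪ AddSep))
    -- One component recorded as unwinnable refutes the conjunction over all components, so skipping
    -- the separator loses nothing.
    ... | yes failed = reject (λ ws →
            let Comp , Comp∈ , m = find failed
            in All.lookup (Sound.fails inv) m (All.lookup ws Comp∈)) inv
    ... | no _
      with decompSub E rec (separate E (CovSep ∪ AddSep))
             (components-smaller E (CovSep ∪ AddSep) (separator-meets E CovSep AddSep A∈))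
             (CovSep ∪ AddSep) [] s
         | decompSub-decides (separate E (CovSep ∪ AddSep))
             (components-smaller E (CovSep ∪ AddSep) (separator-meets E CovSep AddSep A∈))
             (CovSep ∪ AddSep) [] s inv
    ...   | just _ , _ | accept ws inv′ = accept ws inv′
    ...   | nothing , _ | reject ¬ws inv′ = reject ¬ws inv′

    decompAdd-decides : ∀ C CovSep →
      Decides ((Nonempty (CovSep ∩ E) ⊎ k ∸ ∣ CovSep ∣ > 0) ×
               ∃ λ AddSep → AddSep ∈ˡ subsets E (addSize (CovSep ∩ E)) ×
                 All (λ Comp → Solvable (CovSep ∪ AddSep , Comp)) (separate E (CovSep ∪ AddSep)))
              (decompAdd E rec C CovSep)
    decompAdd-decides C CovSep s inv with nonempty? (CovSep ∩ E) ⊎-dec (k ∸ ∣ CovSep ∣ >? 0)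
    ... | yes allowed = verdict-map (allowed ,_) proj₂
            (forEach-decides _ _ (trySeparator-decides C CovSep) s inv)
    ... | no ¬allowed = reject (¬allowed ∘ proj₁) inv

  decompCov-decides : ∀ E (a : Acc _<_ ∣ E ∣) C → Decides (Win E C) (decompCov E a C)
  decompCov-decides E (acc rs) C s inv with ∣ E ∣ ≤? k
  ... | yes E≤k = accept (leaf E≤k) inv
  ... | no E≰k = verdict-map
      (λ (CovSep , Cov∈ , allowed , AddSep , Add∈ , ws) → split Cov∈ allowed Add∈ (All.lookup ws))
      (λ { (leaf E≤k) → contradiction E≤k E≰k
         ; (split Cov∈ allowed Add∈ ws) → _ , Cov∈ , allowed , _ , Add∈ , All.tabulate ws })
      (forEach-decides _ _ (λ CovSep _ →
        decompAdd-decides E _ (λ Comp lt → decompCov-decides Comp (rs lt)) C CovSep) s inv)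

-- From a win to a decomposition of width at most `k`.

∣p∪q∣≤∣p∣+∣q∣ : ∀ {n} (p q : Subset n) → ∣ p ∪ q ∣ ≤ ∣ p ∣ + ∣ q ∣
∣p∪q∣≤∣p∣+∣q∣ [] [] = z≤n
∣p∪q∣≤∣p∣+∣q∣ (outside ∷ p) (outside ∷ q) = ∣p∪q∣≤∣p∣+∣q∣ p q
∣p∪q∣≤∣p∣+∣q∣ (outside ∷ p) (inside ∷ q) =
  ≤-trans (s≤s (∣p∪q∣≤∣p∣+∣q∣ p q)) (≤-reflexive (sym (+-suc ∣ p ∣ ∣ q ∣)))
∣p∪q∣≤∣p∣+∣q∣ (inside ∷ p) (outside ∷ q) = s≤s (∣p∪q∣≤∣p∣+∣q∣ p q)
∣p∪q∣≤∣p∣+∣q∣ (inside ∷ p) (inside ∷ q) =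
  s≤s (≤-trans (∣p∪q∣≤∣p∣+∣q∣ p q) (+-monoʳ-≤ ∣ p ∣ (n≤1+n ∣ q ∣)))

module _ {A B : Set} {R : A → B → Set} where

  collect : ∀ ys → (∀ {y} → y ∈ˡ ys → ∃ λ x → R x y) → ∃ λ xs → Pointwise R xs ys
  collect [] f = [] , []
  collect (y ∷ ys) f =
    let x , r = f (here refl) ; xs , rs = collect ys (f ∘ there) in x ∷ xs , r ∷ rs

  partner : ∀ {xs ys x} → Pointwise R xs ys → x ∈ˡ xs → ∃ λ y → y ∈ˡ ys × R x y
  partner (r ∷ rs) (here refl) = _ , here refl , r
  partner (r ∷ rs) (there i) = let y , y∈ , r′ = partner rs i in y , there y∈ , r′

  partner⁻ : ∀ {xs ys y} → Pointwise R xs ys → y ∈ˡ ys → ∃ λ x → x ∈ˡ xs × R x y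
  partner⁻ (r ∷ rs) (here refl) = _ , here refl , r
  partner⁻ (r ∷ rs) (there i) = let x , x∈ , r′ = partner⁻ rs i in x , there x∈ , r′

  -- Partners at different positions of `ys` have different values by `Unique`. The conclusion
  -- identifies positions and not only elements, because equal trees may be different children.
  partner-injective : ∀ {xs ys x x′} (rs : Pointwise R xs ys) → Unique ys →
                      (i : x ∈ˡ xs) (j : x′ ∈ˡ xs) →
                      proj₁ (partner rs i) ≡ proj₁ (partner rs j) →
                      _≡_ {A = ∃ (_∈ˡ xs)} (x , i) (x′ , j)
  partner-injective (r ∷ rs) (ne ∷ u) (here refl) (here refl) eq = refl
  partner-injective (r ∷ rs) (ne ∷ u) (here refl) (there j) eq =
    contradiction eq (All.lookup ne (proj₁ (proj₂ (partner rs j))))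
  partner-injective (r ∷ rs) (ne ∷ u) (there i) (here refl) eq =
    contradiction (sym eq) (All.lookup ne (proj₁ (proj₂ (partner rs i))))
  partner-injective (r ∷ rs) (ne ∷ u) (there i) (there j) eq
    with refl ← partner-injective rs u i j eq = refl

module _ (H : Hypergraph) where
  open Hypergraph H

  module _ {L : EdgeSet H} {X : VertexSet H} {ts : List (Hypertree H)} {v : Fin order} where

    private
      Along : ∀ {t} → Node H t → Node H t → Set
      Along p q = ParentOf H p q × v ∈ χ[_] H p × v ∈ χ[_] H q

    -- If `v ∈ X`, each occurrence is linked to the root of its child and from there to the new
    -- root; if not, all occurrences lie in one child, at one position.
    consistent-node :
      (∀ {t} → t ∈ˡ ts → Consistent H t v) →
      (∀ {t} → t ∈ˡ ts → v ∈ X → Occurs H v t → v ∈ χ-label H t) →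
      (∀ {t t′} (i : t ∈ˡ ts) (j : t′ ∈ˡ ts) → v ∉ X → Occurs H v t → Occurs H v t′ →
        _≡_ {A = ∃ (_∈ˡ ts)} (t , i) (t′ , j)) →
      Consistent H (node L X ts) v
    consistent-node con roots apart p q v∈p v∈q with v ∈? X
    ... | yes v∈X = Eq.symmetric Along (fromRoot p v∈p) ◅◅ fromRoot q v∈q
      where
      fromRoot : ∀ p → v ∈ χ[_] H p → EqClosure Along root p
      fromRoot root          v∈p = ε
      fromRoot (descend i p) v∈p =
        let v∈t = roots i v∈X (p , v∈p) in
        Eq.return (here i , v∈X , v∈t) ◅◅
        Eq.gmap (descend i) (λ (e , v∈a , v∈b) → there i e , v∈a , v∈b) (con i root p v∈t v∈p)
    ... | no v∉X = case p q v∈p v∈q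
      where
      case : ∀ p q → v ∈ χ[_] H p → v ∈ χ[_] H q → EqClosure Along p q
      case root          q             v∈p v∈q = contradiction v∈p v∉X
      case (descend i p) root          v∈p v∈q = contradiction v∈q v∉X
      case (descend i p) (descend j q) v∈p v∈q with refl ← apart i j v∉X (p , v∈p) (q , v∈q) =
        Eq.gmap (descend i) (λ (e , v∈a , v∈b) → there i e , v∈a , v∈b) (con i p q v∈p v∈q)

  maxWidth-lub : ∀ {m ts} → (∀ {t} → t ∈ˡ ts → width H t ≤ m) → maxWidth H ts ≤ m
  maxWidth-lub {ts = []} h = z≤n
  maxWidth-lub {ts = t ∷ ts} h = ⊔-lub (h (here refl)) (maxWidth-lub (h ∘ there))

  component-∋ : ∀ {S W X v} → IsComponent H S W X → v ∈ ⋃ H (edgesMeeting H S X) → v ∉ W → v ∈ X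
  component-∋ isX v∈ v∉W =
    let e , e∈ , v∈e = ∈-⋃⁻ H v∈ ; e∈S , u , u∈e , u∈X = ∈-edgesMeeting⁻ H e∈
    in component-closed H isX e∈S u∈e u∈X v∈e v∉W

  represents-⊆ : ∀ {S Sep Comp} → Represents H S Sep Comp → Comp ⊆ S
  represents-⊆ (X , _ , refl) = proj₁ ∘ ∈-edgesMeeting⁻ H

  represents-unique : ∀ {S Sep Comp Comp′ v} →
                      Represents H S Sep Comp → Represents H S Sep Comp′ →
                      v ∈ ⋃ H Comp → v ∈ ⋃ H Comp′ → v ∉ ⋃ H Sep → Comp ≡ Comp′
  represents-unique {S} (X , isX , refl) (Y , isY , refl) v∈X v∈Y v∉ =
    cong (edgesMeeting H S) (component-unique H isX isY (component-∋ isX v∈X v∉) (component-∋ isY v∈Y v∉))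

  represents-covers : ∀ {S Sep e v} → e ∈ S → v ∈ edge e → v ∉ ⋃ H Sep →
                      ¬ ¬ ∃ λ Comp → Represents H S Sep Comp × e ∈ Comp
  represents-covers e∈S v∈e v∉ ¬∃ = component-exists H (∈-⋃⁺ H e∈S v∈e) v∉ λ (X , isX , v∈X) →
    ¬∃ (_ , (X , isX , refl) , ∈-edgesMeeting⁺ H e∈S v∈e v∈X)

  -- A decomposition relative to one call. The fields `interface` and `within` are for gluing: the
  -- former links a child to the label of its parent, the latter lets siblings share vertices only
  -- inside the separator.
  record Decomposes (k : ℕ) (E : EdgeSet H) (C : VertexSet H) (t : Hypertree H) : Set where
    field
      interface  : C ⊆ χ-label H t
      within     : ∀ {v} → Occurs H v t → v ∈ ⋃ H E
      covered    : ∀ {e} → e ∈ E → ∃ λ (p : Node H t) → edge e ⊆ χ[_] H p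
      consistent : ∀ v → Consistent H t v
      χ⊆⋃λ       : ∀ (p : Node H t) → χ[_] H p ⊆ ⋃ H (λ[_] H p)
      special    : ∀ (p : Node H t) {v} → v ∈ ⋃ H (λ[_] H p) → Occurs H v (subtree H p) → v ∈ χ[_] H p
      narrow     : width H t ≤ k

  decomposes-leaf : ∀ {k E C} → ∣ E ∣ ≤ k → C ⊆ ⋃ H E → Decomposes k E C (node E (⋃ H E) [])
  decomposes-leaf {k} E≤k C⊆ = record
    { interface  = C⊆
    ; within     = λ { (root , v∈) → v∈ }
    ; covered    = λ e∈E → root , ∈-⋃⁺ H e∈E
    ; consistent = λ { v root root _ _ → ε }
    ; χ⊆⋃λ       = λ { root → id }
    ; special    = λ { root v∈ _ → v∈ }
    ; narrow     = ⊔-lub E≤k z≤n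
    }

  module _ {k : ℕ} {E Sep : EdgeSet H} {C : VertexSet H} {comps : List (EdgeSet H)} {ts : List (Hypertree H)}
    (Sep≤k : ∣ Sep ∣ ≤ k) (C⊆⋃E : C ⊆ ⋃ H E) (C⊆⋃Sep : C ⊆ ⋃ H Sep)
    (unique : Unique comps)
    (reps : ∀ {Comp} → Comp ∈ˡ comps → Represents H E Sep Comp)
    (complete : ∀ {Comp} → Represents H E Sep Comp → Comp ∈ˡ comps)
    (children : Pointwise (λ t Comp → Decomposes k Comp (⋃ H Comp ∩ ⋃ H Sep) t) ts comps) where

    open Decomposes

    private
      -- This contains the label `Conn ∪ ⋃ H (InCovSep ∪ AddSep)` built by the algorithm, and may be
      -- larger.
      X = ⋃ H Sep ∩ ⋃ H E

      occurs-⋃ : ∀ {t v} (i : t ∈ˡ ts) → Occurs H v t → v ∈ ⋃ H (proj₁ (partner children i))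
      occurs-⋃ i = within (proj₂ (proj₂ (partner children i)))

      rep : ∀ {t} (i : t ∈ˡ ts) → Represents H E Sep (proj₁ (partner children i))
      rep i = reps (proj₁ (proj₂ (partner children i)))

      occurs-⋃E : ∀ {t v} (i : t ∈ˡ ts) → Occurs H v t → v ∈ ⋃ H E
      occurs-⋃E i occ = ⋃-mono H (represents-⊆ (rep i)) (occurs-⋃ i occ)

      covered-node : ∀ {e} → e ∈ E → ∃ λ (p : Node H (node Sep X ts)) → edge e ⊆ χ[_] H p
      covered-node {e} e∈E with any? (λ v → (v ∈? edge e) ×-dec ¬? (v ∈? ⋃ H Sep))
      ... | no none = root , λ {v} v∈e → x∈p∩q⁺
        (decidable-stable (v ∈? ⋃ H Sep) (λ v∉ → none (v , v∈e , v∉)) , ∈-⋃⁺ H e∈E v∈e)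
      ... | yes (v , v∈e , v∉) =
        -- Whether `e` belongs to a listed component is decidable, which removes the double negation
        -- of `represents-covers`.
        let Comp , Comp∈ , e∈Comp = find (decidable-stable (Any.any? (e ∈?_) comps) λ ¬any →
              represents-covers e∈E v∈e v∉ λ (_ , r , e∈Comp) → ¬any (lose (complete r) e∈Comp))
            t , i , d = partner⁻ children Comp∈
            p , e⊆ = covered d e∈Comp
        in descend i p , e⊆

    decomposes-node : Decomposes k E C (node Sep X ts)
    decomposes-node = record
      { interface  = λ v∈ → x∈p∩q⁺ (C⊆⋃Sep v∈ , C⊆⋃E v∈)
      ; within     = within-node
      ; covered    = covered-node
      ; consistent = λ v → consistent-node
          (λ i → consistent (proj₂ (proj₂ (partner children i))) v)
          (λ i v∈X occ → interface (proj₂ (proj₂ (partner children i)))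
            (x∈p∩q⁺ (occurs-⋃ i occ , proj₁ (x∈p∩q⁻ _ _ v∈X))))
          -- A vertex occurring in a child lies in `⋃ H E`, so outside `X` it also lies outside the
          -- separator and determines its component.
          (λ i j v∉X occ occ′ → partner-injective children unique i j
            (represents-unique (rep i) (rep j) (occurs-⋃ i occ) (occurs-⋃ j occ′)
              λ v∈Sep → v∉X (x∈p∩q⁺ (v∈Sep , occurs-⋃E i occ))))
      ; χ⊆⋃λ       = λ { root → p∩q⊆p _ _ ; (descend i p) → χ⊆⋃λ (proj₂ (proj₂ (partner children i))) p }
      ; special    = λ { root v∈ occ → x∈p∩q⁺ (v∈ , within-node occ)
                       ; (descend i p) → special (proj₂ (proj₂ (partner children i))) p }
      ; narrow     = ⊔-lub Sep≤k (maxWidth-lub λ i → narrow (proj₂ (proj₂ (partner children i))))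
      }
      where
      within-node : ∀ {v} → Occurs H v (node Sep X ts) → v ∈ ⋃ H E
      within-node (root , v∈) = proj₂ (x∈p∩q⁻ _ _ v∈)
      within-node (descend i p , v∈) = occurs-⋃E i (p , v∈)

module _ (k : ℕ) (H : Hypergraph) (procedures : Procedures H k) where
  open Hypergraph H
  open Procedures procedures
  open Algorithm k H procedures
  open Equivalence

  -- If `CovSep` meets `E`, nothing is added; otherwise one hyperedge is added, and then the guard
  -- gives `∣ CovSep ∣ < k`.
  separator-small : ∀ {E CovSep AddSep} → ∣ CovSep ∣ ≤ k →
                    Nonempty (CovSep ∩ E) ⊎ k ∸ ∣ CovSep ∣ > 0 →
                    AddSep ∈ˡ subsets E (addSize (CovSep ∩ E)) → ∣ CovSep ∪ AddSep ∣ ≤ k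
  separator-small {E} {CovSep} {AddSep} Cov≤k allowed Add∈ with nonempty? (CovSep ∩ E)
  ... | yes _ = begin
    ∣ CovSep ∪ AddSep ∣     ≤⟨ ∣p∪q∣≤∣p∣+∣q∣ CovSep AddSep ⟩
    ∣ CovSep ∣ + ∣ AddSep ∣ ≡⟨ cong (∣ CovSep ∣ +_) (proj₂ (to (subsets-spec E 0 AddSep) Add∈)) ⟩
    ∣ CovSep ∣ + 0          ≡⟨ +-identityʳ _ ⟩
    ∣ CovSep ∣              ≤⟨ Cov≤k ⟩
    k                       ∎
    where open ≤-Reasoning
  ... | no ¬ne with allowed
  ...   | inj₁ ne = contradiction ne ¬ne
  ...   | inj₂ k∸Cov>0 = begin
    ∣ CovSep ∪ AddSep ∣     ≤⟨ ∣p∪q∣≤∣p∣+∣q∣ CovSep AddSep ⟩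
    ∣ CovSep ∣ + ∣ AddSep ∣ ≡⟨ cong (∣ CovSep ∣ +_) (proj₂ (to (subsets-spec E 1 AddSep) Add∈)) ⟩
    ∣ CovSep ∣ + 1          ≡⟨ +-comm _ 1 ⟩
    suc ∣ CovSep ∣          ≤⟨ m∸n≢0⇒n<m (m<n⇒n≢0 k∸Cov>0) ⟩
    k                       ∎
    where open ≤-Reasoning

  win⇒decomposes : ∀ {E C} → Win k H procedures E C → C ⊆ ⋃ H E → ∃ (Decomposes H k E C)
  win⇒decomposes (leaf E≤k) C⊆ = _ , decomposes-leaf H E≤k C⊆
  win⇒decomposes {E} {C} (split {CovSep} {AddSep} Cov∈ allowed Add∈ wins) C⊆ =
    let ts , children = collect (separate E (CovSep ∪ AddSep))
                          (λ Comp∈ → win⇒decomposes (wins Comp∈) (p∩q⊆p _ _))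
    in _ , decomposes-node H
      (separator-small small allowed Add∈) C⊆
      (⋃-mono H (p⊆p∪q AddSep) ∘ covers)
      (separate-unique E _) (to (separate-spec E _ _)) (from (separate-spec E _ _)) children
    where open IsBoundedCover (cover-sound _ _ _ Cov∈)

-- Minimal covers, regions still to be decomposed, and conditions inherited by subtrees.

module _ (H : Hypergraph) where
  open Hypergraph H

  -- Hyperedges are deleted while the rest still covers. This is needed because `cover` promises to
  -- return only the minimal covers.
  minimal-cover : ∀ {k C B S} → IsBoundedCover H k C B S →
                  ∃ λ T → T ⊆ S × IsBoundedCover H k C B T ×
                    (∀ U → IsBoundedCover H k C B U → U ⊆ T → U ≡ T)
  minimal-cover {k} {C} {B} {S} = shrink (<-wellFounded ∣ S ∣)
    where
    shrink : ∀ {S} → Acc _<_ ∣ S ∣ → IsBoundedCover H k C B S →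
             ∃ λ T → T ⊆ S × IsBoundedCover H k C B T ×
               (∀ U → IsBoundedCover H k C B U → U ⊆ T → U ≡ T)
    shrink {S} (acc rs) cov with any? (λ e → (e ∈? S) ×-dec (C ⊆? ⋃ H (S - e)))
    ... | yes (e , e∈S , C⊆) =
      let T , T⊆ , rest = shrink (rs (x∈p⇒∣p-x∣<∣p∣ e∈S)) record
            { bounded = IsBoundedCover.bounded cov ∘ p─q⊆p S ⁅ e ⁆
            ; small   = ≤-trans (<⇒≤ (x∈p⇒∣p-x∣<∣p∣ e∈S)) (IsBoundedCover.small cov)
            ; covers  = C⊆ }
      in T , p─q⊆p S ⁅ e ⁆ ∘ T⊆ , rest
    -- A cover `U ⊆ S` missing some `e ∈ S` would be contained in `S - e`, which would then cover as
    -- well.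
    ... | no irredundant = S , id , cov , λ U covU U⊆S → ⊆-antisym U⊆S λ {e} e∈S →
      decidable-stable (e ∈? U) λ e∉U → irredundant (e , e∈S ,
        ⋃-mono H (λ u∈U → x∈p∧x≢y⇒x∈p-y (U⊆S u∈U) λ { refl → e∉U u∈U }) ∘ IsBoundedCover.covers covU)

  -- X is the part still to be decomposed, E its hyperedges and C its boundary.
  record Region (X : VertexSet H) (E : EdgeSet H) (C : VertexSet H) : Set where
    field
      meets    : ∀ {e} → e ∈ E → ∃ λ v → v ∈ edge e × v ∈ X
      absorbs  : ∀ {e v} → v ∈ edge e → v ∈ X → e ∈ E
      C⊆⋃E     : C ⊆ ⋃ H E
      disjoint : ∀ {v} → v ∈ C → v ∉ X
      boundary : ∀ {v} → v ∈ ⋃ H E → v ∉ X → v ∈ C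

  -- Avoiding `∁ X` encodes that paths stay inside `X`.
  Linked : VertexSet H → Set
  Linked X = Nonempty X × Connected H (edges H) (∁ X) X

  linked-induction : ∀ {X u v} → Linked X → (Q : Fin order → Set) →
                     (∀ {e x y} → x ∈ X → x ∈ edge e → y ∈ edge e → Q x → Q y) →
                     u ∈ X → v ∈ X → Q u → Q v
  linked-induction {X} (_ , connected) Q spread u∈X v∈X = along (connected u∈X v∈X)
    where
    along : ∀ {u v} → Star (Step H (edges H) (∁ X)) u v → Q u → Q v
    along ε qu = qu
    along (step e _ u∈e w∈e u∉ _ ◅ path) qu = along path (spread (x∉∁p⇒x∈p u∉) u∈e w∈e qu)

  everything : Region ⊤ (edges H) ⊥
  everything = record
    { meets    = λ {e} _ → let v , v∈e = edge-nonempty e in v , v∈e , ∈⊤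
    ; absorbs  = λ _ _ → ∈⊤
    ; C⊆⋃E     = ⊥⊆
    ; disjoint = λ v∈⊥ → contradiction v∈⊥ ∉⊥
    ; boundary = λ _ v∉⊤ → contradiction ∈⊤ v∉⊤
    }

  module _ {X E C Sep X′} (region : Region X E C) (C⊆ : C ⊆ ⋃ H Sep)
           (isX′ : IsComponent H E (⋃ H Sep) X′) where
    open Region region
    open IsComponent isX′
    open IsConnectedPart isConnectedPart

    -- A vertex of `X′` outside `X` would be a boundary vertex, hence in the separator.
    component-⊆ : X′ ⊆ X
    component-⊆ {v} v∈X′ = decidable-stable (v ∈? X) λ v∉X →
      avoids v∈X′ (C⊆ (boundary (within v∈X′) v∉X))

    component-region : Region X′ (edgesMeeting H E X′) (⋃ H (edgesMeeting H E X′) ∩ ⋃ H Sep)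
    component-region = record
      { meets    = proj₂ ∘ ∈-edgesMeeting⁻ H
      ; absorbs  = λ v∈e v∈X′ → ∈-edgesMeeting⁺ H (absorbs v∈e (component-⊆ v∈X′)) v∈e v∈X′
      ; C⊆⋃E     = p∩q⊆p _ _
      ; disjoint = λ v∈C v∈X′ → avoids v∈X′ (proj₂ (x∈p∩q⁻ _ _ v∈C))
      ; boundary = λ {v} v∈ v∉X′ → x∈p∩q⁺ (v∈ , decidable-stable (v ∈? ⋃ H Sep) λ v∉ →
          let e , e∈ , v∈e = ∈-⋃⁻ H v∈ ; e∈E , u , u∈e , u∈X′ = ∈-edgesMeeting⁻ H e∈
          in v∉X′ (component-closed H isX′ e∈E u∈e u∈X′ v∈e v∉))
      }

    -- A path that avoids the separator cannot leave `X′`, by `component-closed` at each step.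
    component-linked : Linked X′
    component-linked = nonempty , λ u∈X′ v∈X′ → narrow u∈X′ (connected u∈X′ v∈X′)
      where
      narrow : ∀ {u v} → u ∈ X′ → Star (Step H E (⋃ H Sep)) u v → Star (Step H (edges H) (∁ X′)) u v
      narrow u∈X′ ε = ε
      narrow u∈X′ (step e e∈E u∈e v∈e u∉ v∉ ◅ path) =
        let v∈X′ = component-closed H isX′ e∈E u∈e u∈X′ v∈e v∉
        in step e ∈⊤ u∈e v∈e (x∈p⇒x∉∁p u∈X′) (x∈p⇒x∉∁p v∈X′) ◅ narrow v∈X′ path

  -- The conditions that pass to subtrees. Covering all hyperedges does not, so it is tracked by
  -- `CoveredIn` for the hyperedges of the current region.
  record Valid (k : ℕ) (t : Hypertree H) : Set where
    field
      consistent : ∀ v → Consistent H t v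
      χ⊆⋃λ       : ∀ (p : Node H t) → χ[_] H p ⊆ ⋃ H (λ[_] H p)
      special    : ∀ (p : Node H t) {v} → v ∈ ⋃ H (λ[_] H p) → Occurs H v (subtree H p) → v ∈ χ[_] H p
      narrow     : width H t ≤ k

  width≤maxWidth : ∀ {t ts} → t ∈ˡ ts → width H t ≤ maxWidth H ts
  width≤maxWidth (here refl) = m≤m⊔n _ _
  width≤maxWidth (there {x = t} i) = ≤-trans (width≤maxWidth i) (m≤n⊔m (width H t) _)

  valid-child : ∀ {k L X ts t} → Valid k (node L X ts) → t ∈ˡ ts → Valid k t
  valid-child {L = L} valid i = record
    { consistent = λ v → consistent-child H (consistent v) i
    ; χ⊆⋃λ       = χ⊆⋃λ ∘ descend i
    ; special    = special ∘ descend i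
    ; narrow     = ≤-trans (width≤maxWidth i) (≤-trans (m≤n⊔m ∣ L ∣ _) narrow)
    }
    where open Valid valid

  CoveredIn : Hypertree H → Fin size → Set
  CoveredIn t e = ∃ λ (p : Node H t) → edge e ⊆ χ[_] H p

  -- The invariant kept while descending from the root through nodes with empty χ-label.
  Closed : Hypertree H → Set
  Closed t = ∀ {e v} → v ∈ edge e → Occurs H v t → CoveredIn t e

  -- The node covering `e` contains `v`, and since `v ∉ X` all nodes containing `v` lie in the same
  -- child.
  covered-child : ∀ {k L X ts t e v} → Valid k (node L X ts) → t ∈ˡ ts → v ∉ X → Occurs H v t →
                  v ∈ edge e → CoveredIn (node L X ts) e → CoveredIn t e
  covered-child {e = e} valid i v∉X occ v∈e (r , e⊆) =
    let q , eq = same-child H (Valid.consistent valid _) i v∉X occ r (e⊆ v∈e)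
    in q , subst (edge e ⊆_) (sym eq) e⊆

-- From a decomposition of width at most `k` to a win.

module _ (k : ℕ) (H : Hypergraph) (procedures : Procedures H k) where
  open Hypergraph H
  open Procedures procedures
  open Algorithm k H procedures
  open Equivalence

  private
    Wins = Win k H procedures

  -- If `CovSep` misses `E`, then `e` is a hyperedge of `L` outside `CovSep`. Hence
  -- `∣ CovSep ∣ < ∣ L ∣ ≤ k`, and `e` itself can be added.
  augment : ∀ {L E CovSep e} → ∣ L ∣ ≤ k → CovSep ⊆ L → e ∈ L → e ∈ E →
            (Nonempty (CovSep ∩ E) ⊎ k ∸ ∣ CovSep ∣ > 0) ×
            ∃ λ AddSep → AddSep ∈ˡ subsets E (addSize (CovSep ∩ E)) ×
              CovSep ∪ AddSep ⊆ L
  augment {L} {E} {CovSep} {e} L≤k Cov⊆L e∈L e∈E with nonempty? (CovSep ∩ E)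
  ... | yes ne = inj₁ ne , ⊥ , from (subsets-spec E 0 ⊥) (⊥⊆ , ∣⊥∣≡0 size) , ∪⊆
    where
    ∪⊆ : CovSep ∪ ⊥ ⊆ L
    ∪⊆ x∈ with x∈p∪q⁻ CovSep ⊥ x∈
    ... | inj₁ x∈C = Cov⊆L x∈C
    ... | inj₂ x∈⊥ = contradiction x∈⊥ ∉⊥
  ... | no ¬ne = inj₂ (m<n⇒0<n∸m Cov<k) , ⁅ e ⁆ , from (subsets-spec E 1 ⁅ e ⁆) (⁅e⁆⊆ e∈E , ∣⁅x⁆∣≡1 e) , ∪⊆
    where
    Cov<k : ∣ CovSep ∣ < k
    Cov<k = <-≤-trans (p⊂q⇒∣p∣<∣q∣ (Cov⊆L , e , e∈L , λ e∈C → ¬ne (e , x∈p∩q⁺ (e∈C , e∈E)))) L≤k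
    ⁅e⁆⊆ : ∀ {S : EdgeSet H} → e ∈ S → ⁅ e ⁆ ⊆ S
    ⁅e⁆⊆ e∈S x∈ with refl ← x∈⁅y⁆⇒x≡y e x∈ = e∈S
    ∪⊆ : CovSep ∪ ⁅ e ⁆ ⊆ L
    ∪⊆ x∈ with x∈p∪q⁻ CovSep ⁅ e ⁆ x∈
    ... | inj₁ x∈C = Cov⊆L x∈C
    ... | inj₂ x∈e = ⁅e⁆⊆ e∈L x∈e

  -- The labels of a decomposition are not followed exactly: a minimal cover of the
  -- boundary inside L, with one hyperedge of L added if necessary, makes progress.
  win-step : ∀ {X E C L e} → Region H X E C → ∣ L ∣ ≤ k → C ⊆ ⋃ H L → e ∈ L → e ∈ E →
             (∀ {X′ E′ C′} → Region H X′ E′ C′ → Linked H X′ → X′ ⊆ X → ∣ E′ ∣ < ∣ E ∣ →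
               C′ ⊆ ⋃ H L → Wins E′ C′) →
             Wins E C
  win-step {X} {E} {C} {L} region L≤k C⊆⋃L e∈L e∈E continue =
    let CovSep , Cov⊆ , cov , minimal = minimal-cover H {S = edgesMeeting H L C} record
          { bounded = λ e∈ → let _ , _ , v∈e , v∈C = ∈-edgesMeeting⁻ H e∈ in ∈-edgesMeeting⁺ H ∈⊤ v∈e v∈C
          ; small   = ≤-trans (p⊆q⇒∣p∣≤∣q∣ (proj₁ ∘ ∈-edgesMeeting⁻ H)) L≤k
          ; covers  = λ v∈C → let f , f∈L , v∈f = ∈-⋃⁻ H (C⊆⋃L v∈C)
                              in ∈-⋃⁺ H (∈-edgesMeeting⁺ H f∈L v∈f v∈C) v∈f
          }
        allowed , AddSep , Add∈ , Sep⊆L = augment L≤k (proj₁ ∘ ∈-edgesMeeting⁻ H ∘ Cov⊆) e∈L e∈E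
        C⊆⋃Sep : C ⊆ ⋃ H (CovSep ∪ AddSep)
        C⊆⋃Sep = ⋃-mono H (p⊆p∪q AddSep) ∘ IsBoundedCover.covers cov
        f , f∈E , f∈Sep = separator-meets E CovSep AddSep Add∈
    in split (cover-complete _ _ _ cov minimal) allowed Add∈ λ {Comp} Comp∈ →
         next Sep⊆L C⊆⋃Sep f∈E f∈Sep (to (separate-spec E _ Comp) Comp∈)
    where
    next : ∀ {Sep f Comp} → Sep ⊆ L → C ⊆ ⋃ H Sep → f ∈ E → f ∈ Sep →
           Represents H E Sep Comp → Wins Comp (⋃ H Comp ∩ ⋃ H Sep)
    next {Sep} Sep⊆L C⊆⋃Sep f∈E f∈Sep rep@(X′ , isX′ , refl) = continue
      (component-region H region C⊆⋃Sep isX′) (component-linked H region C⊆⋃Sep isX′)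
      (component-⊆ H region C⊆⋃Sep isX′) (component-smaller H E Sep _ rep f∈E f∈Sep)
      (⋃-mono H Sep⊆L ∘ proj₂ ∘ x∈p∩q⁻ _ _)

  Follows : Hypertree H → Set
  Follows t = ∀ {X E C} → Region H X E C → Linked H X → (∀ {e} → e ∈ E → CoveredIn H t e) →
              C ⊆ χ-label H t → Wins E C

  -- The induction on `∣ E ∣` is nested inside the one on the tree: a separator may use only part of
  -- `L`, so the search can stay at one node for several steps.
  follows-node : ∀ {L Y ts} → Valid H k (node L Y ts) → (∀ {t} → t ∈ˡ ts → Follows t) →
                 Follows (node L Y ts)
  follows-node {L} {Y} {ts} valid children {E = E} = descent (<-wellFounded ∣ E ∣)
    where
    open Valid valid

    descent : ∀ {X E C} → Acc _<_ ∣ E ∣ → Region H X E C → Linked H X →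
              (∀ {e} → e ∈ E → CoveredIn H (node L Y ts) e) → C ⊆ Y → Wins E C
    descent {X} {E} {C} (acc rs) region linked@((x , x∈X) , _) covered C⊆Y with nonempty? (L ∩ E)
    ... | yes (e , e∈) =
      win-step region (≤-trans (m≤m⊔n ∣ L ∣ _) narrow) (χ⊆⋃λ root ∘ C⊆Y)
        (p∩q⊆p L E e∈) (p∩q⊆q L E e∈)
        λ region′ linked′ X′⊆X smaller C′⊆⋃L →
          let covered′ = λ {f} f∈E′ → let v , v∈f , v∈X′ = Region.meets region′ f∈E′
                                  in covered {f} (Region.absorbs region v∈f (X′⊆X v∈X′))
          -- A new boundary vertex lies in `⋃ H L` and in a hyperedge covered below this node, so
          -- the special condition places it in `Y`.
          in descent (rs smaller) region′ linked′ covered′ λ v∈C′ →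
               let f , f∈E′ , v∈f = ∈-⋃⁻ H (Region.C⊆⋃E region′ v∈C′)
                   p , f⊆ = covered′ f∈E′
               in special root (C′⊆⋃L v∈C′) (p , f⊆ v∈f)
    ... | no none = inOneChild (covered (absorbs x∈e₀ x∈X))
      where
      open Region region
      e₀ = proj₁ (no-isolated x)
      x∈e₀ = proj₂ (no-isolated x)

      -- A hyperedge of `L` through a vertex of `X` would belong to `E`, but `L` and `E` are
      -- disjoint here.
      untouched : ∀ {v} → v ∈ X → v ∉ Y
      untouched v∈X v∈Y = let e , e∈L , v∈e = ∈-⋃⁻ H (χ⊆⋃λ root v∈Y)
                          in none (e , x∈p∩q⁺ (e∈L , absorbs v∈e v∈X))

      inOneChild : CoveredIn H (node L Y ts) e₀ → Wins E C
      inOneChild (root , e₀⊆) = contradiction (e₀⊆ x∈e₀) (untouched x∈X)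
      -- As `X` is linked and misses `Y`, occurrence in the child spreads from `x` to all of `X`.
      -- Boundary vertices lie in `Y` and occur in the child, hence in its root label.
      inOneChild (descend {t = t} i p , e₀⊆) = children i region linked covered′ λ v∈C →
          let e , e∈E , v∈e = ∈-⋃⁻ H (C⊆⋃E v∈C)
              q , e⊆ = covered′ e∈E
          in occurs-root H (consistent _) i (C⊆Y v∈C) (q , e⊆ v∈e)
        where
        descends : ∀ {e v} → v ∈ X → v ∈ edge e → Occurs H v t → CoveredIn H t e
        descends v∈X v∈e occ =
          covered-child H valid i (untouched v∈X) occ v∈e (covered (absorbs v∈e v∈X))

        covered′ : ∀ {e} → e ∈ E → CoveredIn H t e
        covered′ e∈E with v , v∈e , v∈X ← meets e∈E = descends v∈X v∈e
          (linked-induction H linked (λ v → Occurs H v t)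
            (λ u∈X u∈e w∈e occ → let q , e⊆ = descends u∈X u∈e occ in q , e⊆ w∈e)
            x∈X v∈X (p , e₀⊆ x∈e₀))

  mutual
    follows : ∀ t → Valid H k t → Follows t
    follows (node L Y ts) valid = follows-node valid (λ i → follows-all ts i (valid-child H valid i))

    -- Walking along the list makes the recursion on children structural.
    follows-all : ∀ ts {t} → t ∈ˡ ts → Valid H k t → Follows t
    follows-all (t ∷ ts) (here refl) = follows t
    follows-all (t ∷ ts) (there i)   = follows-all ts i

  -- The first call is made on the whole hypergraph, which may be disconnected while the
  -- root label is empty; e is taken from a topmost node with a nonempty χ-label.
  Opening : Hypertree H → Fin size → Set
  Opening t e = (∀ {v} → v ∈ edge e → Occurs H v t) ×
    (∀ {X E C} → Region H X E C → Linked H X → (∀ {v} → v ∈ X → Occurs H v t) →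
      C ⊆ edge e → Wins E C)

  opening-node : ∀ {L Y ts} → Valid H k (node L Y ts) → Closed H (node L Y ts) →
                 ∃ (λ v → Occurs H v (node L Y ts)) →
                 (∀ {t} → t ∈ˡ ts → Closed H t → ∃ (λ v → Occurs H v t) → ∃ (Opening t)) →
                 ∃ (Opening (node L Y ts))
  opening-node {L} {Y} {ts} valid closed (v , p , v∈p) children with nonempty? Y
  ... | yes (u , u∈Y) =
    let e , e∈L , u∈e = ∈-⋃⁻ H (χ⊆⋃λ root u∈Y)
        q , e⊆ = closed u∈e (root , u∈Y)
    in e , (λ w∈e → q , e⊆ w∈e) , λ region linked occurs C⊆e →
      follows (node L Y ts) valid region linked
        (λ f∈E → let w , w∈f , w∈X = Region.meets region f∈E in closed w∈f (occurs w∈X))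
        -- All vertices of `e` occur in this tree and `e ∈ L`, so the special condition puts the
        -- whole of `e` into `Y`.
        (λ w∈C → special root (∈-⋃⁺ H e∈L (C⊆e w∈C)) (q , e⊆ (C⊆e w∈C)))
    where open Valid valid
  ... | no empty with p
  ...   | root = contradiction (_ , v∈p) empty
  ...   | descend {t = t} i q = opening (children i closed-t (v , q , v∈p))
    where
    closed-t : Closed H t
    closed-t u∈e occ@(r , u∈r) = covered-child H valid i (λ u∈Y → empty (_ , u∈Y)) occ u∈e
      (closed u∈e (descend i r , u∈r))

    opening : ∃ (Opening t) → ∃ (Opening (node L Y ts))
    opening (e , e-occurs , wins) = e , (λ w∈e → let r , w∈r = e-occurs w∈e in descend i r , w∈r) , win
      where
      win : ∀ {X E C} → Region H X E C → Linked H X → (∀ {v} → v ∈ X → Occurs H v (node L Y ts)) →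
            C ⊆ edge e → Wins E C
      win {X} {E} {C} region linked occurs C⊆e with nonempty? C
      -- Without a boundary the region may lie below any child; the whole tree guides it, as the
      -- empty boundary fits even the empty root label.
      ... | no C-empty = follows (node L Y ts) valid region linked
        (λ f∈E → let w , w∈f , w∈X = Region.meets region f∈E in closed w∈f (occurs w∈X))
        (λ w∈C → contradiction (_ , w∈C) C-empty)
      -- A boundary vertex lies in `e` and so occurs in `t`; linkedness then carries all of `X` into
      -- `t`.
      ... | yes (u , u∈C) =
        let f , f∈E , u∈f = ∈-⋃⁻ H (Region.C⊆⋃E region u∈C)
            w , w∈f , w∈X = Region.meets region f∈E
            r , f⊆ = closed-t u∈f (e-occurs (C⊆e u∈C))
        in wins region linked (λ x∈X → linked-induction H linked (λ x → Occurs H x t)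
             (λ y∈X y∈g z∈g occ → let s , g⊆ = closed-t y∈g occ in s , g⊆ z∈g)
             w∈X x∈X (r , f⊆ w∈f)) C⊆e

  mutual
    opening-exists : ∀ t → Valid H k t → Closed H t → ∃ (λ v → Occurs H v t) → ∃ (Opening t)
    opening-exists (node L Y ts) valid closed occ =
      opening-node valid closed occ (λ i → opening-all ts i (valid-child H valid i))

    opening-all : ∀ ts {t} → t ∈ˡ ts → Valid H k t → Closed H t → ∃ (λ v → Occurs H v t) → ∃ (Opening t)
    opening-all (t ∷ ts) (here refl) = opening-exists t
    opening-all (t ∷ ts) (there i)   = opening-all ts i

  ∣λ∣≤width : ∀ {t} (p : Node H t) → ∣ λ[_] H p ∣ ≤ width H t
  ∣λ∣≤width {node L _ _} root = m≤m⊔n ∣ L ∣ _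
  ∣λ∣≤width {node L _ _} (descend i p) =
    ≤-trans (∣λ∣≤width p) (≤-trans (width≤maxWidth H i) (m≤n⊔m ∣ L ∣ _))

  decomposition⇒win : ∀ {t} → IsHypertreeDecomposition H t → width H t ≤ k → Wins (edges H) ⊥
  decomposition⇒win {t} dec narrow with nonempty? (edges H)
  ... | no empty = leaf (subst (λ S → ∣ S ∣ ≤ k) (sym (Empty-unique empty)) (subst (_≤ k) (sym (∣⊥∣≡0 size)) z≤n))
  ... | yes (e₀ , _) =
    let v , v∈e₀ = edge-nonempty e₀
        p , e₀⊆ = edges-covered e₀
        f , f∈λ , _ = ∈-⋃⁻ H (χ⊆⋃λ p (e₀⊆ v∈e₀))
        e , _ , wins = opening-exists t valid (λ {g} _ _ → edges-covered g) (v , p , e₀⊆ v∈e₀)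
        -- Some λ-label contains the hyperedge `f`, so the width is at least one.
        1≤k = ≤-trans (≤-reflexive (sym (∣⁅x⁆∣≡1 f)))
               (≤-trans (p⊆q⇒∣p∣≤∣q∣ λ x∈f → subst (_∈ λ[_] H p) (sym (x∈⁅y⁆⇒x≡y f x∈f)) f∈λ)
                 (≤-trans (∣λ∣≤width p) narrow))
    -- The first separator is chosen inside `⁅ e ⁆`, so every remaining region has its boundary
    -- inside `edge e`, as `Opening` requires.
    in win-step (everything H) (subst (_≤ k) (sym (∣⁅x⁆∣≡1 e)) 1≤k) ⊥⊆ (x∈⁅x⁆ e) ∈⊤
         λ region linked _ _ C⊆ → wins region linked (λ {x} _ → occurs x) λ x∈C →
           let g , g∈ , x∈g = ∈-⋃⁻ H (C⊆ x∈C)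
           in subst (λ g → _ ∈ edge g) (x∈⁅y⁆⇒x≡y e g∈) x∈g
    where
    open IsHypertreeDecomposition dec
    valid : Valid H k t
    valid = record { consistent = connectedness ; χ⊆⋃λ = χ⊆⋃λ ; special = special ; narrow = narrow }
    occurs : ∀ v → Occurs H v t
    occurs v = let e , v∈e = no-isolated v ; p , e⊆ = edges-covered e in p , e⊆ v∈e

-- Acceptance and the minimum width.

module _ (H : Hypergraph) where
  open Hypergraph H

  Width≤ : ℕ → Set
  Width≤ k = ∃ λ t → IsHypertreeDecomposition H t × width H t ≤ k

  win⇒width≤ : ∀ {k} procedures → Win k H procedures (edges H) ⊥ → Width≤ k
  win⇒width≤ procedures win = t , dec , narrow
    where
    t = proj₁ (win⇒decomposes _ H procedures win ⊥⊆)
    open Decomposes (proj₂ (win⇒decomposes _ H procedures win ⊥⊆))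
    dec : IsHypertreeDecomposition H t
    dec = record
      { edges-covered = λ e → covered ∈⊤ ; connectedness = consistent
      ; χ⊆⋃λ = χ⊆⋃λ ; special = special }

  accepts⇔win : ∀ {k} procedures →
                Algorithm.Accepts k H procedures ⇔ Win k H procedures (edges H) ⊥
  accepts⇔win {k} procedures
    with Algorithm.decompCov k H procedures (edges H) (<-wellFounded ∣ edges H ∣) ⊥ (Algorithm.state [] [])
       | decompCov-decides k H procedures (edges H) (<-wellFounded ∣ edges H ∣) ⊥ _ (sound [] [])
  ... | just _  , _ | accept win _ = mk⇔ (λ _ → win) (λ _ → MaybeAny.just tt)
  ... | nothing , _ | reject ¬win _ = mk⇔ (λ ()) (λ win → contradiction win ¬win)

  win? : ∀ {k} procedures → Dec (Win k H procedures (edges H) ⊥)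
  win? procedures = map′ (to (accepts⇔win procedures)) (from (accepts⇔win procedures))
    (MaybeAny.dec (λ _ → yes tt) (Algorithm.det-k-decomp _ H procedures))
    where open Equivalence

  -- A cover minimal for `j` is minimal for `k` too, since any cover inside it is no larger and so
  -- also respects the bound `j`.
  restrict : ∀ {j k} → j ≤ k → Procedures H k → Procedures H j
  restrict {j} {k} j≤k procedures = record
    { Procedures procedures hiding (cover; cover-sound; cover-complete)
    ; cover          = λ C B → filter small? (cover C B)
    ; cover-sound    = λ C B S S∈ → let S∈′ , S≤j = ∈-filter⁻ small? S∈
                                    in record { IsBoundedCover (cover-sound C B S S∈′) ; small = S≤j }
    ; cover-complete = λ C B S cov minimal → ∈-filter⁺ small?
        (cover-complete C B S (relax cov) λ U covU U⊆S → minimal U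
          record { IsBoundedCover covU ; small = ≤-trans (p⊆q⇒∣p∣≤∣q∣ U⊆S) (IsBoundedCover.small cov) } U⊆S)
        (IsBoundedCover.small cov)
    }
    where
    open Procedures procedures
    small? = λ (S : EdgeSet H) → ∣ S ∣ ≤? j
    relax : ∀ {C B S} → IsBoundedCover H j C B S → IsBoundedCover H k C B S
    relax cov = record { IsBoundedCover cov ; small = ≤-trans (IsBoundedCover.small cov) j≤k }

  -- Whether a smaller width is possible is decided by running the algorithm with a smaller k.
  minimise : ∀ {j} → Procedures H j → Width≤ j → ∃ λ w → IsHypertreeWidth H w × w ≤ j
  minimise {zero} procedures (t , dec , narrow) = 0 , ((t , dec , n≤0⇒n≡0 narrow) , λ _ _ → z≤n) , z≤n
  minimise {suc j} procedures (t , dec , narrow)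
    with restricted ← restrict (n≤1+n j) procedures
    with win? restricted
  ... | yes win = let w , isW , w≤j = minimise restricted (win⇒width≤ restricted win) in w , isW , m≤n⇒m≤1+n w≤j
  -- A decomposition of width at most `j` would give a win with bound `j`, so `suc j` is attained
  -- and least.
  ... | no ¬win = suc j , ((t , dec , ≤-antisym narrow (minimal t dec)) , minimal) , ≤-refl
    where
    minimal : ∀ t → IsHypertreeDecomposition H t → j < width H t
    minimal t dec = ≰⇒> (¬win ∘ decomposition⇒win j H restricted dec)

theorem1 : (k : ℕ) .{{_ : NonZero k}} (H : Hypergraph) (procedures : Procedures H k) →
    Algorithm.Accepts k H procedures ⇔ (∃ λ w → IsHypertreeWidth H w × w ≤ k)
theorem1 k H procedures = mk⇔
  (minimise H procedures ∘ win⇒width≤ H procedures ∘ to (accepts⇔win H procedures))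
  (λ (w , ((t , dec , eq) , _) , w≤k) → from (accepts⇔win H procedures)
    (decomposition⇒win k H procedures dec (subst (_≤ k) (sym eq) w≤k)))
  where open Equivalence
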